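{- For every integer $p\ge 1$ there exist a positive integer $k$ and a $k$-colorable ($2K_2$, $4K_1$, co-diamond, co-claw)-free graph that is not $(k+p)$-mixing.
   Context: All graphs are finite and simple. A $k$-coloring of $G$ is a map $V(G)\to\{1,\dots,k\}$ giving adjacent vertices different values; $G$ is $k$-colorable if it has a $k$-coloring. $R_k(G)$ denotes the graph whose vertices are the $k$-colorings of $G$, two being adjacent if they differ in color on exactly one vertex. $G$ is $\ell$-mixing if $R_\ell(G)$ is connected. A graph is $(H_1,\dots,H_r)$-free if it has no induced subgraph isomorphic to any $H_i$. $2K_2$ is the disjoint union of two edges; $4K_1$ is the edgeless graph on 4 vertices; the co-diamond is $K_2+2K_1$ (4 vertices, one edge); the co-claw is $K_3+K_1$ (disjoint union of a triangle and a single vertex). -}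

module Defs where

open import Data.Empty using (⊥)
open import Data.Fin.Base using (Fin)
open import Data.Fin.Properties using (_≟_; any?; all?)
open import Data.Fin.Subset using (Subset; _∈_)
open import Data.Nat.Base using (ℕ)
open import Data.Product using (Σ-syntax; ∃; ∃!; _×_; _,_; proj₁; map₂)
open import Data.Sum.Base using (_⊎_)
open import Data.Sum.Relation.Binary.Pointwise
  using (Pointwise; inj₁; inj₂; ⊎-symmetric; ⊎-decidable)
open import Data.Vec.Base using (Vec; lookup)
open import Function.Base using (_∘_)
open import Function.Bundles using (_↔_; _⇔_; module Inverse)
open import Level using (0ℓ)
open import Relation.Binary.Core using (Rel)
open import Relation.Binary.Definitions
  using (Symmetric; Irreflexive; Decidable; Universal)
open import Relation.Binary.Construct.Closure.ReflexiveTransitive using (Star)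
open import Relation.Binary.PropositionalEquality
  using (_≡_; _≢_; refl; ≢-sym)
open import Relation.Nullary.Decidable
  using (Dec; yes; no; ¬?; _×-dec_; _→-dec_; map′)
open import Relation.Nullary.Negation using (¬_)

record Graph (V : Set) : Set₁ where
  infix 4 _~_ _~?_
  field
    _~_    : Rel V 0ℓ
    ~-sym  : Symmetric _~_
    ~-irr  : Irreflexive _≡_ _~_
    _~?_   : Decidable _~_

Connected : {V : Set} → Graph V → Set
Connected G = Universal (Star (Graph._~_ G))

infix 4 _≅_

_≅_ : {V W : Set} → Graph V → Graph W → Set
_≅_ {V} {W} G H =
  Σ[ f ∈ V ↔ W ] (∀ u v → (u G.~ v) ⇔ (Inverse.to f u H.~ Inverse.to f v))
  where
  module G = Graph G
  module H = Graph H

induced : {n : ℕ} → Graph (Fin n) → (S : Subset n) → Graph (∃ (_∈ S))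
induced G S = record
  { _~_   = λ u v → proj₁ u ~ proj₁ v
  ; ~-sym = ~-sym
  ; ~-irr = λ { refl → ~-irr refl }
  ; _~?_  = λ u v → proj₁ u ~? proj₁ v
  }
  where open Graph G

infix 4 _IsFreeOf_

_IsFreeOf_ : {n : ℕ} {W : Set} → Graph (Fin n) → Graph W → Set
_IsFreeOf_ {n} G H = ¬ (Σ[ S ∈ Subset n ] induced G S ≅ H)

complete : (n : ℕ) → Graph (Fin n)
complete n = record
  { _~_   = _≢_
  ; ~-sym = ≢-sym
  ; ~-irr = λ u≡v u≢v → u≢v u≡v
  ; _~?_  = λ u v → ¬? (u ≟ v)
  }

edgeless : (n : ℕ) → Graph (Fin n)
edgeless n = record
  { _~_   = λ _ _ → ⊥
  ; ~-sym = λ ()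
  ; ~-irr = λ _ ()
  ; _~?_  = λ _ _ → no λ ()
  }

infixr 6 _⊕_

-- Disjoint union: Pointwise relates nothing across the two summands.
_⊕_ : {V W : Set} → Graph V → Graph W → Graph (V ⊎ W)
G ⊕ H = record
  { _~_   = Pointwise G._~_ H._~_
  ; ~-sym = ⊎-symmetric G.~-sym H.~-sym
  ; ~-irr = λ { refl (inj₁ u~u) → G.~-irr refl u~u
              ; refl (inj₂ u~u) → H.~-irr refl u~u }
  ; _~?_  = ⊎-decidable G._~?_ H._~?_
  }
  where
  module G = Graph G
  module H = Graph H

2K₂ : Graph (Fin 2 ⊎ Fin 2)
2K₂ = complete 2 ⊕ complete 2

4K₁ : Graph (Fin 4)
4K₁ = edgeless 4

co-diamond : Graph (Fin 2 ⊎ Fin 2)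
co-diamond = complete 2 ⊕ edgeless 2

co-claw : Graph (Fin 3 ⊎ Fin 1)
co-claw = complete 3 ⊕ complete 1

-- Colourings are vectors with an irrelevant properness proof, rather than
-- functions, so that _≡_ on colourings is pointwise equality of colours; with
-- functions, the trivial path in R k G would only join colourings that are
-- intensionally equal.
record Coloring {n : ℕ} (G : Graph (Fin n)) (k : ℕ) : Set where
  constructor coloring
  open Graph G
  field
    colors  : Vec (Fin k) n
    .proper : ∀ u v → u ~ v → lookup colors u ≢ lookup colors v

  color : Fin n → Fin k
  color = lookup colors

open Coloring public using (color)

Colorable : {n : ℕ} → ℕ → Graph (Fin n) → Set
Colorable k G = Coloring G k

R : {n : ℕ} (k : ℕ) (G : Graph (Fin n)) → Graph (Coloring G k)
R {n} k G = record
  { _~_   = λ α β → ∃! _≡_ (Differ α β)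
  ; ~-sym = λ { (v , d , unique) → v , ≢-sym d , unique ∘ ≢-sym }
  ; ~-irr = λ { refl (v , d , _) → d refl }
  ; _~?_  = λ α β → map′
      (map₂ (map₂ (λ unique {u} → unique u)))
      (map₂ (map₂ (λ unique u → unique {u})))
      (any? λ v → differ? α β v ×-dec all? λ u → differ? α β u →-dec (v ≟ u))
  }
  where
  Differ : Coloring G k → Coloring G k → Fin n → Set
  Differ α β v = color α v ≢ color β v

  differ? : ∀ α β v → Dec (Differ α β v)
  differ? α β v = ¬? (color α v ≟ color β v)

Mixing : {n : ℕ} → ℕ → Graph (Fin n) → Set
Mixing ℓ G = Connected (R ℓ G)

{-# OPTIONS --safe #-}

-- In complements, the task is to find a (C₄, K₄, diamond, claw)-free graph whose
-- vertices can be partitioned into k cliques, and also into k + p cliques none of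
-- which can be enlarged by a further vertex: the latter is a colouring that is
-- isolated in R. Replacing each vertex of a simple cubic graph F by a triangle
-- gives such a graph: its vertices are the darts of F, partitioned into triangles
-- by their endpoints and into pairs by their edges. With F the disjoint union of
-- p copies of K₃,₃, there are 6p triangles and 9p pairs, so that k = 8p works.
module Submission where

open import Defs
open import Data.Empty using (⊥; ⊥-elim-irr)
open import Data.Fin.Base using (Fin; inject≤)
open import Data.Fin.Patterns using (0F; 1F; 2F; 3F)
open import Data.Fin.Properties
  using (_≟_; *↔×; inject≤-injective; pigeonhole; <⇒≢)
open import Data.Nat.Base using (ℕ; suc; _+_; _*_; _≤_; s≤s; z≤n)
open import Data.Nat.Properties using (≤-refl; m≤m+n; *-monoʳ-≤; *-suc; +-comm)
open import Data.Product.Base using (Σ-syntax; ∃-syntax; _×_; _,_; proj₁; proj₂)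
open import Data.Product.Function.NonDependent.Propositional using (_×-↔_)
open import Data.Product.Properties using (≡-dec; Σ-≡,≡→≡)
open import Data.Sum.Base using (_⊎_; inj₁; inj₂)
import Data.Sum.Relation.Binary.Pointwise as Pointwise
open import Data.Vec.Base using (Vec; tabulate; _[_]=_; here; there)
open import Data.Vec.Properties using (lookup∘tabulate)
open import Function.Base using (_∘_; _on_)
open import Function.Bundles
  using (_↔_; module Inverse; module Injection; module Equivalence)
open import Function.Construct.Composition using (_↔-∘_)
open import Function.Construct.Identity using (↔-id)
open import Function.Construct.Symmetry using (↔-sym)
open import Function.Definitions using (Injective)
open import Function.Properties.Inverse using (↔⇒↣)
open import Relation.Binary.Construct.Closure.ReflexiveTransitive using (ε; _◅_)
open import Relation.Binary.Definitions using (DecidableEquality)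
open import Relation.Binary.PropositionalEquality
  using (_≡_; _≢_; refl; sym; trans; cong; subst; subst₂; ≢-sym; module ≡-Reasoning)
open import Relation.Nullary.Irrelevant using (Irrelevant)
open import Relation.Nullary.Decidable using (yes; no; ¬?; _×-dec_; decidable-stable)
open import Relation.Nullary.Negation using (¬_; contradiction)

-- Induced embeddings, and freeness under relabelling of vertices.

infix 4 _↪_

record _↪_ {V W : Set} (H : Graph W) (G : Graph V) : Set where
  private
    module G = Graph G
    module H = Graph H
  field
    to        : W → V
    injective : Injective _≡_ _≡_ to
    preserves : ∀ {a b} → a H.~ b → to a G.~ to b
    reflects  : ∀ {a b} → to a G.~ to b → a H.~ b

pullback : {V W : Set} → (W → V) → Graph V → Graph W
pullback f G = record
  { _~_   = _~_ on f
  ; ~-sym = ~-sym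
  ; ~-irr = ~-irr ∘ cong f
  ; _~?_  = λ u v → f u ~? f v
  }
  where open Graph G

↔-injective : {A B : Set} (e : A ↔ B) → Injective _≡_ _≡_ (Inverse.to e)
↔-injective e = Injection.injective (↔⇒↣ e)

-- This makes vertices of `induced G S` equal as soon as their underlying vertices in `G` are.
[]=-irrelevant : {A : Set} {n : ℕ} {xs : Vec A n} {i : Fin n} {x : A} →
                 Irrelevant (xs [ i ]= x)
[]=-irrelevant here      here      = refl
[]=-irrelevant (there p) (there q) = cong there ([]=-irrelevant p q)

-- Inverting the isomorphism with an induced subgraph and then applying `e` embeds `H` in `G`, so
-- exclusion can be argued on the structured type `V`.
pullback-free : {n : ℕ} {V W : Set} {G : Graph V} {H : Graph W} (e : Fin n ↔ V) →
                ¬ (H ↪ G) → pullback (Inverse.to e) G IsFreeOf H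
pullback-free {G = G} {H} e ¬emb (S , f , f-iso) = ¬emb record
  { to        = λ a → e.to (proj₁ (f.from a))
  ; injective = λ {a} {b} eq → begin
      a                ≡⟨ f.strictlyInverseˡ a ⟨
      f.to (f.from a)  ≡⟨ cong f.to (Σ-≡,≡→≡ (↔-injective e eq , []=-irrelevant _ _)) ⟩
      f.to (f.from b)  ≡⟨ f.strictlyInverseˡ b ⟩
      b                ∎
  ; preserves = λ {a} {b} a~b → Equivalence.from (f-iso (f.from a) (f.from b))
      (subst₂ H._~_ (sym (f.strictlyInverseˡ a)) (sym (f.strictlyInverseˡ b)) a~b)
  ; reflects  = λ {a} {b} fa~fb → subst₂ H._~_ (f.strictlyInverseˡ a) (f.strictlyInverseˡ b)
      (Equivalence.to (f-iso (f.from a) (f.from b)) fa~fb)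
  }
  where
  open ≡-Reasoning
  module e = Inverse e
  module f = Inverse f
  module H = Graph H

-- Frozen colourings.

module _ {n : ℕ} {G : Graph (Fin n)} where
  open Graph G

  tabulateColoring : {k : ℕ} (f : Fin n → Fin k) → (∀ {u v} → u ~ v → f u ≢ f v) →
                     Coloring G k
  tabulateColoring f f-proper = coloring (tabulate f) λ u v u~v eq →
    f-proper u~v
      (trans (sym (lookup∘tabulate f u)) (trans eq (lookup∘tabulate f v)))

  Frozen : {k : ℕ} → Coloring G k → Set
  Frozen α = ∀ v c → color α v ≢ c → ∃[ w ] (v ~ w × color α w ≡ c)

  -- If `α` and `β` differ only at `v`, a neighbour of `v` with colour `β v` under `α` keeps it
  -- under `β`, which is then improper.
  frozen⇒isolated : {k : ℕ} {α β : Coloring G k} → Frozen α → ¬ (Graph._~_ (R k G) α β)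
  frozen⇒isolated {α = α} {β@(coloring _ proper)} frozen (v , αv≢βv , unique)
    with frozen v (color β v) αv≢βv
  ... | w , v~w , αw≡βv = ⊥-elim-irr (proper v w v~w βv≡βw)
    where
    αw≡βw : color α w ≡ color β w
    -- Otherwise `w` would be `v`, the only vertex of difference, and `v` would be its own
    -- neighbour.
    αw≡βw = decidable-stable (color α w ≟ color β w) λ αw≢βw →
      ~-irr (unique αw≢βw) v~w

    βv≡βw : color β v ≡ color β w
    βv≡βw = trans (sym αw≡βv) αw≡βw

  frozen⇒¬mixing : {k : ℕ} {α β : Coloring G k} → Frozen α → α ≢ β → ¬ Mixing k G
  frozen⇒¬mixing {α = α} {β} frozen α≢β mixing with mixing α β
  ... | ε                 = α≢β refl
  ... | _◅_ {j = γ} α~γ _ = frozen⇒isolated {α = α} {γ} frozen α~γ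

-- Darts of disjoint copies of K₃,₃.

module Darts (p : ℕ) where

  -- (i , s , x , y) is the edge xy of the i-th copy of K₃,₃, directed away from
  -- its endpoint on side s.
  Dart Edge Endpoint : Set
  Dart     = Fin p × Fin 2 × Fin 3 × Fin 3
  Edge     = Fin p × Fin 3 × Fin 3
  Endpoint = Fin p × Fin 2 × Fin 3

  edge : Dart → Edge
  edge (i , _ , x , y) = i , x , y

  end : Dart → Endpoint
  end (i , 0F , x , y) = i , 0F , x
  end (i , 1F , x , y) = i , 1F , y

  opposite : Dart → Fin 3
  opposite (i , 0F , x , y) = y
  opposite (i , 1F , x , y) = x

  -- As `opposite` has three values, this bounds the number of darts with a common end by three.
  end-opposite-injective : ∀ u v → end u ≡ end v → opposite u ≡ opposite v → u ≡ v
  end-opposite-injective (_ , 0F , _) (_ , 0F , _) refl refl = refl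
  end-opposite-injective (_ , 1F , _) (_ , 1F , _) refl refl = refl
  end-opposite-injective (_ , 0F , _) (_ , 1F , _) ()
  end-opposite-injective (_ , 1F , _) (_ , 0F , _) ()

  two-darts-per-edge : ∀ u v w → edge u ≡ edge v → edge u ≡ edge w →
                       u ≡ v ⊎ u ≡ w ⊎ v ≡ w
  two-darts-per-edge (_ , 0F , _) (_ , 0F , _) _            refl refl = inj₁ refl
  two-darts-per-edge (_ , 1F , _) (_ , 1F , _) _            refl refl = inj₁ refl
  two-darts-per-edge (_ , 0F , _) (_ , 1F , _) (_ , 0F , _) refl refl = inj₂ (inj₁ refl)
  two-darts-per-edge (_ , 0F , _) (_ , 1F , _) (_ , 1F , _) refl refl = inj₂ (inj₂ refl)
  two-darts-per-edge (_ , 1F , _) (_ , 0F , _) (_ , 0F , _) refl refl = inj₂ (inj₂ refl)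
  two-darts-per-edge (_ , 1F , _) (_ , 0F , _) (_ , 1F , _) refl refl = inj₂ (inj₁ refl)

  -- If `v` and `w` are distinct, they are the two darts of one edge and their ends are its two
  -- endpoints. The edge of `u` and `x` joins the same endpoints, so it is the same edge, and `u`
  -- and `v` share both end and edge.
  no-parallel-edges : ∀ u v w x → end u ≡ end v → edge v ≡ edge w →
                      end w ≡ end x → edge x ≡ edge u → v ≡ w ⊎ u ≡ v
  no-parallel-edges (_ , 0F , _) (_ , 0F , _) (_ , 0F , _) (_ , 0F , _) refl refl refl refl = inj₁ refl
  no-parallel-edges (_ , 0F , _) (_ , 0F , _) (_ , 1F , _) (_ , 1F , _) refl refl refl refl = inj₂ refl
  no-parallel-edges (_ , 1F , _) (_ , 1F , _) (_ , 0F , _) (_ , 0F , _) refl refl refl refl = inj₂ refl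
  no-parallel-edges (_ , 1F , _) (_ , 1F , _) (_ , 1F , _) (_ , 1F , _) refl refl refl refl = inj₁ refl
  no-parallel-edges (_ , 0F , _) (_ , 1F , _) _            _            ()
  no-parallel-edges (_ , 1F , _) (_ , 0F , _) _            _            ()
  no-parallel-edges (_ , 0F , _) (_ , 0F , _) (_ , 0F , _) (_ , 1F , _) _    _    ()
  no-parallel-edges (_ , 0F , _) (_ , 0F , _) (_ , 1F , _) (_ , 0F , _) _    _    ()
  no-parallel-edges (_ , 1F , _) (_ , 1F , _) (_ , 0F , _) (_ , 1F , _) _    _    ()
  no-parallel-edges (_ , 1F , _) (_ , 1F , _) (_ , 1F , _) (_ , 0F , _) _    _    ()

  _≟-edge_ : DecidableEquality Edge
  _≟-edge_ = ≡-dec _≟_ (≡-dec _≟_ _≟_)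

  _≟-end_ : DecidableEquality Endpoint
  _≟-end_ = ≡-dec _≟_ (≡-dec _≟_ _≟_)

  dartGraph : Graph Dart
  dartGraph = record
    { _~_   = λ u v → end u ≢ end v × edge u ≢ edge v
    ; ~-sym = λ (d , e) → ≢-sym d , ≢-sym e
    ; ~-irr = λ { refl (d , _) → d refl }
    ; _~?_  = λ u v → ¬? (end u ≟-end end v) ×-dec ¬? (edge u ≟-edge edge v)
    }

  open Graph dartGraph

  -- Adjacency or equality in the complement of `dartGraph`.
  Near : Dart → Dart → Set
  Near u v = end u ≡ end v ⊎ edge u ≡ edge v

  ¬~⇒near : ∀ {u v} → ¬ u ~ v → Near u v
  ¬~⇒near {u} {v} u≁v with end u ≟-end end v | edge u ≟-edge edge v
  ... | yes d | _     = inj₁ d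
  ... | no _  | yes e = inj₂ e
  ... | no d  | no e  = contradiction (d , e) u≁v

  -- If `u` and `v` share an edge, then `w`, as a third dart, is not on it. So `w` shares its end
  -- with both, and they share an end with each other.
  near-triangle : ∀ {u v w} → u ≢ v → u ≢ w → v ≢ w →
                  Near u v → Near u w → Near v w → end u ≡ end v
  near-triangle {u} {v} {w} u≢v u≢w v≢w = λ where
      (inj₁ uv) _         _         → uv
      (inj₂ uv) (inj₁ uw) (inj₁ vw) → trans uw (sym vw)
      (inj₂ uv) (inj₂ uw) _         → contradiction uw (edge-uw uv)
      (inj₂ uv) _         (inj₂ vw) → contradiction (trans uv vw) (edge-uw uv)
    where
    edge-uw : edge u ≡ edge v → edge u ≢ edge w
    edge-uw uv uw with two-darts-per-edge u v w uv uw
    ... | inj₁ u≡v        = u≢v u≡v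
    ... | inj₂ (inj₁ u≡w) = u≢w u≡w
    ... | inj₂ (inj₂ v≡w) = v≢w v≡w

  -- The four forbidden subgraphs.

  module _ {W : Set} {H : Graph W} (emb : H ↪ dartGraph) where
    private
      module H = Graph H
      module emb = _↪_ emb

    image-≢ : ∀ {a b} → a ≢ b → emb.to a ≢ emb.to b
    image-≢ a≢b eq = a≢b (emb.injective eq)

    image-near : ∀ {a b} → ¬ a H.~ b → Near (emb.to a) (emb.to b)
    image-near a≁b = ¬~⇒near (λ fa~fb → a≁b (emb.reflects fa~fb))

    image-triangle : ∀ {a b c} → a ≢ b → a ≢ c → b ≢ c →
                     ¬ a H.~ b → ¬ a H.~ c → ¬ b H.~ c →
                     end (emb.to a) ≡ end (emb.to b)
    image-triangle a≢b a≢c b≢c a≁b a≁c b≁c =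
      near-triangle (image-≢ a≢b) (image-≢ a≢c) (image-≢ b≢c)
        (image-near a≁b) (image-near a≁c) (image-near b≁c)

  -- The complement is a 4-cycle. Two consecutive sides of the same kind, both by end or both by
  -- edge, would make a diagonal near, against adjacency; so the kinds alternate, and
  -- `no-parallel-edges` applies.
  2K₂-free : ¬ (2K₂ ↪ dartGraph)
  2K₂-free emb =
    four-cycle (image-near emb λ ()) (image-near emb λ ())
               (image-near emb λ ()) (image-near emb λ ())
    where
    open _↪_ emb

    a₀ a₁ b₀ b₁ : Dart
    a₀ = to (inj₁ 0F)
    a₁ = to (inj₁ 1F)
    b₀ = to (inj₂ 0F)
    b₁ = to (inj₂ 1F)

    a₀~a₁ : a₀ ~ a₁
    a₀~a₁ = preserves {inj₁ 0F} {inj₁ 1F} (Pointwise.inj₁ λ ())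

    b₀~b₁ : b₀ ~ b₁
    b₀~b₁ = preserves {inj₂ 0F} {inj₂ 1F} (Pointwise.inj₂ λ ())

    a≢b : ∀ {i j} → to (inj₁ i) ≢ to (inj₂ j)
    a≢b = image-≢ emb λ ()

    alternating : ∀ {i j k l} →
      end (to (inj₁ i)) ≡ end (to (inj₂ j)) → edge (to (inj₂ j)) ≡ edge (to (inj₁ k)) →
      end (to (inj₁ k)) ≡ end (to (inj₂ l)) → edge (to (inj₂ l)) ≡ edge (to (inj₁ i)) → ⊥
    alternating p₁ p₂ p₃ p₄ with no-parallel-edges _ _ _ _ p₁ p₂ p₃ p₄
    ... | inj₁ b≡a = a≢b (sym b≡a)
    ... | inj₂ a≡b = a≢b a≡b

    four-cycle : Near a₀ b₀ → Near a₁ b₀ → Near a₁ b₁ → Near a₀ b₁ → ⊥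
    four-cycle (inj₁ p) (inj₁ q) _        _        = proj₁ a₀~a₁ (trans p (sym q))
    four-cycle (inj₁ p) (inj₂ q) (inj₂ r) _        = proj₂ b₀~b₁ (trans (sym q) r)
    four-cycle (inj₁ p) (inj₂ q) (inj₁ r) (inj₁ s) = proj₁ a₀~a₁ (trans s (sym r))
    four-cycle (inj₁ p) (inj₂ q) (inj₁ r) (inj₂ s) = alternating p (sym q) r (sym s)
    four-cycle (inj₂ p) (inj₂ q) _        _        = proj₂ a₀~a₁ (trans p (sym q))
    four-cycle (inj₂ p) (inj₁ q) (inj₁ r) _        = proj₁ b₀~b₁ (trans (sym q) r)
    four-cycle (inj₂ p) (inj₁ q) (inj₂ r) (inj₂ s) = proj₂ a₀~a₁ (trans s (sym r))
    -- The cycle is traversed through `b₁` first, so that it begins with a common end.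
    four-cycle (inj₂ p) (inj₁ q) (inj₂ r) (inj₁ s) = alternating s (sym r) q (sym p)

  -- By `image-triangle` all four darts share an end, where there is room for only three.
  4K₁-free : ¬ (4K₁ ↪ dartGraph)
  4K₁-free emb with pigeonhole ≤-refl (opposite ∘ _↪_.to emb)
  ... | i , j , i<j , eq =
    <⇒≢ i<j (injective (end-opposite-injective _ _ (trans (same-end i) (sym (same-end j))) eq))
    where
    open _↪_ emb

    triangle : ∀ {a b c} → a ≢ b → a ≢ c → b ≢ c → end (to a) ≡ end (to b)
    triangle a≢b a≢c b≢c =
      image-triangle emb a≢b a≢c b≢c (λ ()) (λ ()) (λ ())

    same-end : ∀ i → end (to i) ≡ end (to 0F)
    same-end 0F = refl
    same-end 1F = triangle {c = 2F} (λ ()) (λ ()) (λ ())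
    same-end 2F = triangle {c = 1F} (λ ()) (λ ()) (λ ())
    same-end 3F = triangle {c = 1F} (λ ()) (λ ()) (λ ())

  -- Either endpoint of the edge forms an independent triple with the two isolated vertices, so both
  -- endpoints map to darts with the same end.
  co-diamond-free : ¬ (co-diamond ↪ dartGraph)
  co-diamond-free emb =
    proj₁ (preserves {inj₁ 0F} {inj₁ 1F} (Pointwise.inj₁ λ ()))
          (trans (same-end 0F) (sym (same-end 1F)))
    where
    open _↪_ emb

    same-end : ∀ i → end (to (inj₁ i)) ≡ end (to (inj₂ 0F))
    same-end i = image-triangle emb {c = inj₂ 1F}
      (λ ()) (λ ()) (λ ()) (λ ()) (λ ()) (λ { (Pointwise.inj₂ ()) })

  -- Of the three leaves near `c`, two are near it in the same way, so they share an end or an edge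
  -- and cannot be adjacent.
  co-claw-free : ¬ (co-claw ↪ dartGraph)
  co-claw-free emb = claw (near 0F) (near 1F) (near 2F)
    where
    open _↪_ emb

    c : Dart
    c = to (inj₂ 0F)

    leaf : Fin 3 → Dart
    leaf i = to (inj₁ i)

    near : ∀ i → Near (leaf i) c
    near i = image-near emb λ ()

    end-≢ : ∀ {i j} → i ≢ j → end (leaf i) ≡ end c → end (leaf j) ≡ end c → ⊥
    end-≢ i≢j p q = proj₁ (preserves (Pointwise.inj₁ i≢j)) (trans p (sym q))

    edge-≢ : ∀ {i j} → i ≢ j → edge (leaf i) ≡ edge c → edge (leaf j) ≡ edge c → ⊥
    edge-≢ i≢j p q = proj₂ (preserves (Pointwise.inj₁ i≢j)) (trans p (sym q))

    claw : Near (leaf 0F) c → Near (leaf 1F) c → Near (leaf 2F) c → ⊥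
    claw (inj₁ p) (inj₁ q) _        = end-≢ (λ ()) p q
    claw (inj₁ p) (inj₂ q) (inj₁ r) = end-≢ (λ ()) p r
    claw (inj₁ p) (inj₂ q) (inj₂ r) = edge-≢ (λ ()) q r
    claw (inj₂ p) (inj₁ q) (inj₁ r) = end-≢ (λ ()) q r
    claw (inj₂ p) (inj₁ q) (inj₂ r) = edge-≢ (λ ()) p r
    claw (inj₂ p) (inj₂ q) _        = edge-≢ (λ ()) p q

  -- Colourings by endpoint and by edge.

  darts : Fin (p * 18) ↔ Dart
  darts = (↔-id _ ×-↔ ((↔-id _ ×-↔ *↔×) ↔-∘ *↔×)) ↔-∘ *↔×

  edges : Edge ↔ Fin (p * 9)
  edges = ↔-sym ((↔-id _ ×-↔ *↔×) ↔-∘ *↔×)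

  endpoints : Endpoint ↔ Fin (p * 6)
  endpoints = ↔-sym ((↔-id _ ×-↔ *↔×) ↔-∘ *↔×)

  G : Graph (Fin (p * 18))
  G = pullback (Inverse.to darts) dartGraph

  private
    module darts     = Inverse darts
    module edges     = Inverse edges
    module endpoints = Inverse endpoints

  endColor : Fin (p * 18) → Fin (p * 6)
  endColor v = endpoints.to (end (darts.to v))

  edgeColor : Fin (p * 18) → Fin (p * 9)
  edgeColor v = edges.to (edge (darts.to v))

  -- The number of colours is left open because the colouring serves twice: with `p * 8` colours for
  -- colourability, and with `p * 9` as a second vertex of `R`.
  endColoring : ∀ {k} → p * 6 ≤ k → Coloring G k
  endColoring p*6≤k = tabulateColoring (λ v → inject≤ (endColor v) p*6≤k)
    λ (d , _) eq → d (↔-injective endpoints (inject≤-injective _ _ _ _ eq))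

  edgeColoring : Coloring G (p * 9)
  edgeColoring = tabulateColoring edgeColor λ (_ , e) eq → e (↔-injective edges eq)

  color-endColoring : ∀ {k} (h : p * 6 ≤ k) d →
    color (endColoring h) (darts.from d) ≡ inject≤ (endpoints.to (end d)) h
  color-endColoring h d = trans (lookup∘tabulate _ (darts.from d))
    (cong (λ d → inject≤ (endpoints.to (end d)) h) (darts.strictlyInverseˡ d))

  color-edgeColoring : ∀ d → color edgeColoring (darts.from d) ≡ edges.to (edge d)
  color-edgeColoring d = trans (lookup∘tabulate edgeColor _)
    (cong (edges.to ∘ edge) (darts.strictlyInverseˡ d))

  -- The two darts of an edge have ends on opposite sides, so the one on the side other than that of
  -- `a` will do.
  dart-avoiding : ∀ a e → ∃[ d ] (a ≢ end d × edge d ≡ e)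
  dart-avoiding (_ , 0F , _) (i , x , y) = (i , 1F , x , y) , (λ ()) , refl
  dart-avoiding (_ , 1F , _) (i , x , y) = (i , 0F , x , y) , (λ ()) , refl

  edgeColoring-frozen : Frozen edgeColoring
  edgeColoring-frozen v c v≢c
    with dart-avoiding (end (darts.to v)) (edges.from c)
  ... | d , v≢d , d∈c = darts.from d , adjacent , d-color
    where
    d-color : color edgeColoring (darts.from d) ≡ c
    d-color = trans (color-edgeColoring d)
      (trans (cong edges.to d∈c) (edges.strictlyInverseˡ c))

    adjacent : Graph._~_ G v (darts.from d)
    adjacent = subst (darts.to v ~_) (sym (darts.strictlyInverseˡ d))
      ( v≢d
      , λ v≡d → v≢c (trans (lookup∘tabulate edgeColor v)
          (trans (cong edges.to (trans v≡d d∈c)) (edges.strictlyInverseˡ c))) )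

  edgeColoring≢endColoring : Fin p → ∀ h → edgeColoring ≢ endColoring h
  edgeColoring≢endColoring i h eq =
    ends-differ (↔-injective endpoints (inject≤-injective h h _ _ same-color))
    where
    open ≡-Reasoning

    -- The two darts of one edge: equal edge colours, distinct end colours. The copy `i` ensures
    -- that such darts exist.
    u v : Dart
    u = i , 0F , 0F , 0F
    v = i , 1F , 0F , 0F

    ends-differ : end u ≢ end v
    ends-differ ()

    same-color : inject≤ (endpoints.to (end u)) h ≡ inject≤ (endpoints.to (end v)) h
    same-color = begin
      inject≤ (endpoints.to (end u)) h         ≡⟨ color-endColoring h u ⟨
      color (endColoring h) (darts.from u)     ≡⟨ cong (λ α → color α (darts.from u)) eq ⟨
      color edgeColoring (darts.from u)        ≡⟨ color-edgeColoring u ⟩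
      edges.to (edge u)                        ≡⟨ color-edgeColoring v ⟨
      color edgeColoring (darts.from v)        ≡⟨ cong (λ α → color α (darts.from v)) eq ⟩
      color (endColoring h) (darts.from v)     ≡⟨ color-endColoring h v ⟩
      inject≤ (endpoints.to (end v)) h         ∎

theorem13 : (p : ℕ) → 1 ≤ p →
    ∃[ k ] (1 ≤ k × ∃[ n ] Σ[ G ∈ Graph (Fin n) ]
    (Colorable k G
    × G IsFreeOf 2K₂ × G IsFreeOf 4K₁ × G IsFreeOf co-diamond × G IsFreeOf co-claw
    × ¬ Mixing (k + p) G))
theorem13 p@(suc _) _ =
  -- The choice of `k` is forced by `k + p` being the number `p * 9` of edges; it leaves room for
  -- the `p * 6` endpoint colours.
  p * 8 , s≤s z≤n , p * 18 , G
  , endColoring (*-monoʳ-≤ p (m≤m+n 6 2))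
  , pullback-free darts 2K₂-free
  , pullback-free darts 4K₁-free
  , pullback-free darts co-diamond-free
  , pullback-free darts co-claw-free
  , subst (λ ℓ → ¬ Mixing ℓ G) p*9≡p*8+p
      (frozen⇒¬mixing edgeColoring-frozen
        (edgeColoring≢endColoring 0F (*-monoʳ-≤ p (m≤m+n 6 3))))
  where
  open Darts p

  p*9≡p*8+p : p * 9 ≡ p * 8 + p
  p*9≡p*8+p = trans (*-suc p 8) (+-comm p (p * 8))
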